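{- Let $p,q\ge 0$ be integers with $p+q\ge 1$. Then the minimum degree of $A_{p,q}$ is $\delta(A_{p,q})=\min\{1,pq\}$ and its maximum degree is $$\Delta(A_{p,q})=\begin{cases}2\min\{p,q\}, & p\ne q,\\ 2p-1, & p=q.\end{cases}$$ Moreover, the number of vertices of degree $d$ in $A_{p,q}$ is equal to $$\begin{cases}2\binom{p-1}{\frac{d-1}{2}}\binom{q-1}{\frac{d-1}{2}}, & d\text{ is odd},\\[6pt] \binom{p-1}{\frac d2-1}\binom{q-1}{\frac d2}+\binom{p-1}{\frac d2}\binom{q-1}{\frac d2-1}, & d\text{ is even}.\end{cases}$$
   Context: For nonnegative integers $p,q$, the graph $A_{p,q}$ is the simple graph whose vertices are all words of length $p+q$ over the alphabet $\{a,b\}$ with exactly $p$ letters $a$ and $q$ letters $b$; two words are adjacent if one can be obtained from the other by changing one subword (block of consecutive letters) $ab$ to $ba$. Binomial coefficients: $\binom{n}{k}\ge 1$ if and only if $0\le k\le n$, and $\binom nk=0$ otherwise.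
   Formalization: The formula for even d is asserted except when d=0 and pq=0, where it gives 0 under the stated binomial convention although A_{p,q} has a single vertex, of degree 0; in that case the number of vertices of degree 0 is stated to be 1. -}

module Defs where

open import Data.Empty using (⊥-elim)
open import Data.Integer.Base using (ℤ; +_; -[1+_])
open import Data.List.Base using (List; []; _∷_; _++_; map; filter; length)
open import Data.List.Membership.Propositional using (_∈_)
open import Data.List.Membership.Propositional.Properties using (∈-map⁺; ∈-map⁻; ∈-++⁺ˡ; ∈-++⁺ʳ)
open import Data.List.Properties using (++-cancelˡ; ≡-dec; ∷-injectiveˡ; ∷-injectiveʳ)
open import Data.List.Relation.Binary.Disjoint.Propositional using (Disjoint)
open import Data.List.Relation.Unary.All using ([])
open import Data.List.Relation.Unary.AllPairs using ([]; _∷_)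
open import Data.List.Relation.Unary.Any using (here)
open import Data.List.Relation.Unary.Unique.Propositional using (Unique)
open import Data.List.Relation.Unary.Unique.Propositional.Properties using (map⁺; ++⁺)
open import Data.Nat.Base using (ℕ; zero; suc; _+_; _≤_)
open import Data.Nat.Combinatorics using (_C_)
open import Data.Nat.Properties using (_≟_; +-suc; suc-injective; ≡-irrelevant)
open import Data.Product.Base using (_×_; _,_; ∃; ∃₂; proj₂)
open import Data.Sum.Base using (_⊎_; inj₁; inj₂; swap)
open import Function.Base using (case_of_)
open import Relation.Binary.Definitions using (Decidable; DecidableEquality)
open import Relation.Binary.PropositionalEquality using (_≡_; _≢_; refl; sym; trans; cong; subst)
open import Relation.Nullary.Decidable using (Dec; yes; no; _⊎-dec_; map′)
open import Relation.Nullary.Negation using (¬_)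

record FiniteSimpleGraph : Set₁ where
  field
    Vertex   : Set
    Adj      : Vertex → Vertex → Set
    adj?     : Decidable Adj
    symmetric   : ∀ {u v} → Adj u v → Adj v u
    irreflexive : ∀ {v} → ¬ Adj v v
    vertices : List Vertex
    complete : ∀ v → v ∈ vertices
    unique   : Unique vertices

module _ (G : FiniteSimpleGraph) where
  open FiniteSimpleGraph G

  degree : Vertex → ℕ
  degree v = length (filter (adj? v) vertices)

  IsMinDegree : ℕ → Set
  IsMinDegree δ = (∃ λ v → degree v ≡ δ) × (∀ v → δ ≤ degree v)

  IsMaxDegree : ℕ → Set
  IsMaxDegree Δ = (∃ λ v → degree v ≡ Δ) × (∀ v → degree v ≤ Δ)

  #verticesOfDegree : ℕ → ℕ
  #verticesOfDegree d = length (filter (λ v → degree v ≟ d) vertices)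

-- The library's n C k already vanishes for k > n; a negative argument in
-- either position also gives 0, so binom n k is nonzero iff 0 ≤ k ≤ n.
-- In particular binom -1 -1 is 0.
binom : ℤ → ℤ → ℕ
binom (+ n)      (+ k)      = n C k
binom (+ _)      (-[1+ _ ]) = 0
binom (-[1+ _ ]) _          = 0

data Letter : Set where
  a b : Letter

_≟ᴸ_ : DecidableEquality Letter
a ≟ᴸ a = yes refl
a ≟ᴸ b = no λ ()
b ≟ᴸ a = no λ ()
b ≟ᴸ b = yes refl

occurrences : Letter → List Letter → ℕ
occurrences x w = length (filter (_≟ᴸ x) w)

record Word (p q : ℕ) : Set where
  constructor word
  field
    letters  : List Letter
    length≡  : length letters ≡ p + q
    #a≡      : occurrences a letters ≡ p
    #b≡      : occurrences b letters ≡ q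

open Word

-- v is obtained from u by changing one subword ab to ba.
_⇝_ : List Letter → List Letter → Set
u ⇝ v = ∃₂ λ xs ys → u ≡ xs ++ a ∷ b ∷ ys × v ≡ xs ++ b ∷ a ∷ ys

⇝-irrefl : ∀ {u} → ¬ (u ⇝ u)
⇝-irrefl (xs , ys , refl , eq) with ++-cancelˡ xs _ _ eq
... | ()

⇝-∷ : ∀ {x u v} → u ⇝ v → (x ∷ u) ⇝ (x ∷ v)
⇝-∷ {x} (xs , ys , refl , refl) = x ∷ xs , ys , refl , refl

⇝-∷⁻ : ∀ {x u v} → (x ∷ u) ⇝ (x ∷ v) → u ⇝ v
⇝-∷⁻ ([]     , ys , refl , ())
⇝-∷⁻ (_ ∷ xs , ys , refl , refl) = xs , ys , refl , refl

⇝-∷-≢ : ∀ {x y u v} → (x ∷ u) ⇝ (y ∷ v) → x ≢ y →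
        x ≡ a × y ≡ b × ∃ λ ys → u ≡ b ∷ ys × v ≡ a ∷ ys
⇝-∷-≢ ([]    , ys , refl , refl) x≢y = refl , refl , ys , refl , refl
⇝-∷-≢ (_ ∷ _ , _  , eq   , eq′)  x≢y =
  ⊥-elim (x≢y (trans (∷-injectiveˡ eq) (sym (∷-injectiveˡ eq′))))

_⇝?_ : Decidable _⇝_
[]      ⇝? v       = no λ { ([] , _ , () , _) ; (_ ∷ _ , _ , () , _) }
(_ ∷ _) ⇝? []      = no λ { ([] , _ , _ , ()) ; (_ ∷ _ , _ , _ , ()) }
(a ∷ u) ⇝? (a ∷ v) = map′ ⇝-∷ ⇝-∷⁻ (u ⇝? v)
(b ∷ u) ⇝? (b ∷ v) = map′ ⇝-∷ ⇝-∷⁻ (u ⇝? v)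
(b ∷ u) ⇝? (a ∷ v) = no λ s → case ⇝-∷-≢ s (λ ()) of λ { (() , _) }
(a ∷ u) ⇝? (b ∷ v) = map′ to (λ s → proj₂ (proj₂ (⇝-∷-≢ s λ ()))) (match u v)
  where
  to : ∀ {u v} → (∃ λ ys → u ≡ b ∷ ys × v ≡ a ∷ ys) → (a ∷ u) ⇝ (b ∷ v)
  to (ys , refl , refl) = [] , ys , refl , refl

  match : ∀ u v → Dec (∃ λ ys → u ≡ b ∷ ys × v ≡ a ∷ ys)
  match []      _       = no λ { (_ , () , _) }
  match (a ∷ _) _       = no λ { (_ , () , _) }
  match (b ∷ _) []      = no λ { (_ , _ , ()) }
  match (b ∷ _) (b ∷ _) = no λ { (_ , _ , ()) }
  match (b ∷ u) (a ∷ v) = map′ (λ { refl → u , refl , refl }) (λ { (_ , refl , refl) → refl })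
                               (≡-dec _≟ᴸ_ u v)

consA : ∀ {p q} → Word p q → Word (suc p) q
consA (word w l m n) = word (a ∷ w) (cong suc l) (cong suc m) n

consB : ∀ {p q} → Word p q → Word p (suc q)
consB {p} {q} (word w l m n) =
  word (b ∷ w) (trans (cong suc l) (sym (+-suc p q))) m (cong suc n)

words : ∀ p q → List (Word p q)
words zero    zero    = word [] refl refl refl ∷ []
words (suc p) zero    = map consA (words p zero)
words zero    (suc q) = map consB (words zero q)
words (suc p) (suc q) = map consA (words p (suc q)) ++ map consB (words (suc p) q)

letters-injective : ∀ {p q} {u v : Word p q} → letters u ≡ letters v → u ≡ v
letters-injective {u = word w l m n} {v = word .w l′ m′ n′} refl
  with refl ← ≡-irrelevant l l′ | refl ← ≡-irrelevant m m′ | refl ← ≡-irrelevant n n′ = refl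

consA-injective : ∀ {p q} {u v : Word p q} → consA u ≡ consA v → u ≡ v
consA-injective eq = letters-injective (∷-injectiveʳ (cong letters eq))

consB-injective : ∀ {p q} {u v : Word p q} → consB u ≡ consB v → u ≡ v
consB-injective eq = letters-injective (∷-injectiveʳ (cong letters eq))

data View : ∀ {p q} → Word p q → Set where
  nil   : View (word [] refl refl refl)
  viaA  : ∀ {p q} (w : Word p q) → View (consA w)
  viaB  : ∀ {p q} (w : Word p q) → View (consB w)

view : ∀ {p q} (w : Word p q) → View w
view (word [] l refl refl) with refl ← ≡-irrelevant l refl = nil
view {suc p} {q} (word (a ∷ w) l m n) =
  subst View (letters-injective refl)
    (viaA (word w (suc-injective l) (suc-injective m) n))
view {p} {suc q} (word (b ∷ w) l m n) =
  subst View (letters-injective refl)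
    (viaB (word w (suc-injective (trans l (+-suc p q))) m (suc-injective n)))

words-complete : ∀ {p q} (w : Word p q) → w ∈ words p q
words-complete w with view w
... | nil = here refl
words-complete {suc p} {zero}  _ | viaA w = ∈-map⁺ consA (words-complete w)
words-complete {suc p} {suc q} _ | viaA w = ∈-++⁺ˡ (∈-map⁺ consA (words-complete w))
words-complete {zero}  {suc q} _ | viaB w = ∈-map⁺ consB (words-complete w)
words-complete {suc p} {suc q} _ | viaB w = ∈-++⁺ʳ _ (∈-map⁺ consB (words-complete w))

consA-consB-disjoint : ∀ {p q} (us : List (Word p (suc q))) (vs : List (Word (suc p) q)) →
                       Disjoint (map consA us) (map consB vs)
consA-consB-disjoint us vs (i , j) with ∈-map⁻ consA i | ∈-map⁻ consB j
... | u , _ , eq | v , _ , eq′ with trans (sym (cong letters eq)) (cong letters eq′)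
... | ()

words-unique : ∀ p q → Unique (words p q)
words-unique zero    zero    = [] ∷ []
words-unique (suc p) zero    = map⁺ consA-injective (words-unique p zero)
words-unique zero    (suc q) = map⁺ consB-injective (words-unique zero q)
words-unique (suc p) (suc q) =
  ++⁺ (map⁺ consA-injective (words-unique p (suc q)))
      (map⁺ consB-injective (words-unique (suc p) q))
      (consA-consB-disjoint (words p (suc q)) (words (suc p) q))

A : ℕ → ℕ → FiniteSimpleGraph
A p q = record
  { Vertex      = Word p q
  ; Adj         = λ u v → (letters u ⇝ letters v) ⊎ (letters v ⇝ letters u)
  ; adj?        = λ u v → (letters u ⇝? letters v) ⊎-dec (letters v ⇝? letters u)
  ; symmetric   = swap
  ; irreflexive = λ { (inj₁ s) → ⇝-irrefl s ; (inj₂ s) → ⇝-irrefl s }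
  ; vertices    = words p q
  ; complete    = words-complete
  ; unique      = words-unique p q
  }

{-# OPTIONS --safe #-}

-- A neighbour of a word arises by exchanging two distinct consecutive letters, so the
-- degree of a word is its number of turns, i.e. one less than its number of runs.  A word
-- with d turns is given by its first letter, x say, together with a composition of the
-- number of letters x into ⌊ d /2⌋ + 1 parts and one of the number of the other letters
-- into ⌈ d /2⌉ parts (the run lengths).  The extremal degrees are then the least and the
-- greatest d for which the resulting count is positive.
module Submission where

open import Defs
open import Data.Integer.Base using (+_; _⊖_; _/ℕ_)
open import Data.List.Base using (List; []; _∷_; _++_; filter; length; map)
open import Data.List.Membership.Propositional using (_∈_; lose)
open import Data.List.Membership.Propositional.Properties
  using (∈-filter⁺; ∈-filter⁻; ∈-map⁺; ∈-map⁻)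
open import Data.List.Membership.Propositional.Properties.WithK using (unique∧set⇒bag)
open import Data.List.Properties
  using (∷-injectiveˡ; ∷-injectiveʳ; filter-++; filter-none; filter-some; filter-≐; length-++; length-map)
open import Data.List.Relation.Binary.BagAndSetEquality using (∼bag⇒↭)
open import Data.List.Relation.Binary.Permutation.Propositional as ↭ using (_↭_; ↭-sym)
open import Data.List.Relation.Binary.Permutation.Propositional.Properties
  using (++⁺ˡ; filter-↭; ↭-length)
open import Data.List.Relation.Unary.All as All using ()
open import Data.List.Relation.Unary.AllPairs using ([]; _∷_)
open import Data.List.Relation.Unary.Any using (here; there)
open import Data.List.Relation.Unary.Unique.Propositional using (Unique)
import Data.List.Relation.Unary.Unique.Propositional.Properties as Unique
open import Data.Nat.Base
  using (ℕ; zero; suc; _+_; _*_; _∸_; _⊓_; _/_; _≤_; _<_; z≤n; s≤s; z<s; pred; ⌊_/2⌋; ⌈_/2⌉)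
open import Data.Nat.Combinatorics using (_C_; nCk+nC[k+1]≡[n+1]C[k+1]; k>n⇒nCk≡0)
open import Data.Nat.Divisibility using (_∣_; divides)
open import Data.Nat.DivMod using (m*n/n≡m)
open import Data.Nat.Properties
open import Data.Product.Base using (_×_; _,_; ∃; proj₂)
open import Data.Sum.Base as Sum using (_⊎_; inj₁; inj₂; [_,_]′)
open import Function.Base using (_∘_)
open import Function.Bundles using (mk⇔)
open import Relation.Binary.PropositionalEquality
open import Relation.Binary.Definitions using (tri<; tri≈; tri>)
open import Relation.Nullary.Decidable using (yes; no)
open import Relation.Nullary.Negation using (¬_; contradiction)
open import Relation.Unary using (Pred; Decidable)

open Word

-- Turns of a word, its list of neighbours, and the degree.

turns : List Letter → ℕ
turns []          = 0
turns (_ ∷ [])    = 0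
turns (a ∷ a ∷ w) = turns (a ∷ w)
turns (b ∷ b ∷ w) = turns (b ∷ w)
turns (a ∷ b ∷ w) = suc (turns (b ∷ w))
turns (b ∷ a ∷ w) = suc (turns (a ∷ w))

_~_ : List Letter → List Letter → Set
u ~ v = u ⇝ v ⊎ v ⇝ u

-- The clauses follow those of `turns`: each turn contributes the one word in which that pair is
-- exchanged.
neighbours : List Letter → List (List Letter)
neighbours []          = []
neighbours (_ ∷ [])    = []
neighbours (a ∷ a ∷ w) = map (a ∷_) (neighbours (a ∷ w))
neighbours (b ∷ b ∷ w) = map (b ∷_) (neighbours (b ∷ w))
neighbours (a ∷ b ∷ w) = (b ∷ a ∷ w) ∷ map (a ∷_) (neighbours (b ∷ w))
neighbours (b ∷ a ∷ w) = (a ∷ b ∷ w) ∷ map (b ∷_) (neighbours (a ∷ w))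

length-neighbours : ∀ w → length (neighbours w) ≡ turns w
length-neighbours []          = refl
length-neighbours (_ ∷ [])    = refl
length-neighbours (a ∷ a ∷ w) = trans (length-map _ (neighbours (a ∷ w))) (length-neighbours (a ∷ w))
length-neighbours (b ∷ b ∷ w) = trans (length-map _ (neighbours (b ∷ w))) (length-neighbours (b ∷ w))
length-neighbours (a ∷ b ∷ w) = cong suc (trans (length-map _ (neighbours (b ∷ w))) (length-neighbours (b ∷ w)))
length-neighbours (b ∷ a ∷ w) = cong suc (trans (length-map _ (neighbours (a ∷ w))) (length-neighbours (a ∷ w)))

-- The entry added at a leading turn changes the first letter, while all mapped entries keep it.
neighbours-unique : ∀ w → Unique (neighbours w)
neighbours-unique []          = []
neighbours-unique (_ ∷ [])    = []
neighbours-unique (a ∷ a ∷ w) = Unique.map⁺ ∷-injectiveʳ (neighbours-unique (a ∷ w))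
neighbours-unique (b ∷ b ∷ w) = Unique.map⁺ ∷-injectiveʳ (neighbours-unique (b ∷ w))
neighbours-unique (a ∷ b ∷ w) =
  All.tabulate (λ { i refl → contradiction (∷-injectiveˡ (proj₂ (proj₂ (∈-map⁻ (a ∷_) i)))) λ () })
  ∷ Unique.map⁺ ∷-injectiveʳ (neighbours-unique (b ∷ w))
neighbours-unique (b ∷ a ∷ w) =
  All.tabulate (λ { i refl → contradiction (∷-injectiveˡ (proj₂ (proj₂ (∈-map⁻ (b ∷_) i)))) λ () })
  ∷ Unique.map⁺ ∷-injectiveʳ (neighbours-unique (a ∷ w))

~-∷ : ∀ {x u v} → u ~ v → (x ∷ u) ~ (x ∷ v)
~-∷ = Sum.map ⇝-∷ ⇝-∷

∈-map-∷⇒~ : ∀ {x u v ws} → (∀ {w} → w ∈ ws → u ~ w) → v ∈ map (x ∷_) ws → (x ∷ u) ~ v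
∈-map-∷⇒~ f i with ∈-map⁻ _ i
... | _ , j , refl = ~-∷ (f j)

∈-neighbours⇒~ : ∀ u {v} → v ∈ neighbours u → u ~ v
∈-neighbours⇒~ (a ∷ a ∷ u) i           = ∈-map-∷⇒~ (∈-neighbours⇒~ (a ∷ u)) i
∈-neighbours⇒~ (b ∷ b ∷ u) i           = ∈-map-∷⇒~ (∈-neighbours⇒~ (b ∷ u)) i
∈-neighbours⇒~ (a ∷ b ∷ u) (here refl) = inj₁ ([] , u , refl , refl)
∈-neighbours⇒~ (a ∷ b ∷ u) (there i)   = ∈-map-∷⇒~ (∈-neighbours⇒~ (b ∷ u)) i
∈-neighbours⇒~ (b ∷ a ∷ u) (here refl) = inj₂ ([] , u , refl , refl)
∈-neighbours⇒~ (b ∷ a ∷ u) (there i)   = ∈-map-∷⇒~ (∈-neighbours⇒~ (a ∷ u)) i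

-- A new first letter can only add an entry at the head, namely when it creates a turn. Iterated,
-- this moves an exchange behind an arbitrary prefix.
∷-∈-neighbours : ∀ x {u v} → v ∈ neighbours u → (x ∷ v) ∈ neighbours (x ∷ u)
∷-∈-neighbours a {a ∷ _} i = ∈-map⁺ _ i
∷-∈-neighbours a {b ∷ _} i = there (∈-map⁺ _ i)
∷-∈-neighbours b {a ∷ _} i = there (∈-map⁺ _ i)
∷-∈-neighbours b {b ∷ _} i = ∈-map⁺ _ i

++-∈-neighbours : ∀ xs {u v} → v ∈ neighbours u → (xs ++ v) ∈ neighbours (xs ++ u)
++-∈-neighbours []       i = i
++-∈-neighbours (x ∷ xs) {u} i = ∷-∈-neighbours x {xs ++ u} (++-∈-neighbours xs {u} i)

~⇒∈-neighbours : ∀ {u v} → u ~ v → v ∈ neighbours u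
~⇒∈-neighbours (inj₁ (xs , _ , refl , refl)) = ++-∈-neighbours xs (here refl)
~⇒∈-neighbours (inj₂ (xs , _ , refl , refl)) = ++-∈-neighbours xs (here refl)

⇝⇒↭ : ∀ {u v} → u ⇝ v → u ↭ v
⇝⇒↭ (xs , _ , refl , refl) = ++⁺ˡ xs (↭.swap a b ↭.refl)

~⇒↭ : ∀ {u v} → u ~ v → u ↭ v
~⇒↭ = [ ⇝⇒↭ , ↭-sym ∘ ⇝⇒↭ ]′

-- Needed to see that every entry of `neighbours` is again a vertex of the same graph: permuting
-- letters preserves the length and both letter counts.
reorder : ∀ {p q v} (w : Word p q) → letters w ↭ v → Word p q
reorder {v = v} (word _ l m n) w↭v = word v
  (trans (sym (↭-length w↭v)) l)
  (trans (sym (↭-length (filter-↭ (_≟ᴸ a) w↭v))) m)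
  (trans (sym (↭-length (filter-↭ (_≟ᴸ b) w↭v))) n)

-- The adjacent vertices and the list `neighbours` are both free of duplicates and have the same
-- members, so one permutes the other and their lengths agree.
degree≡turns : ∀ {p q} (w : Word p q) → degree (A p q) w ≡ turns (letters w)
degree≡turns {p} {q} w = begin
  length adjacent                 ≡⟨ length-map letters adjacent ⟨
  length (map letters adjacent)   ≡⟨ ↭-length (∼bag⇒↭ (unique∧set⇒bag
                                       (Unique.map⁺ letters-injective (Unique.filter⁺ adj? (words-unique p q)))
                                       (neighbours-unique (letters w))
                                       (mk⇔ to from))) ⟩
  length (neighbours (letters w)) ≡⟨ length-neighbours (letters w) ⟩
  turns (letters w)               ∎
  where
  open ≡-Reasoning

  adj?     = FiniteSimpleGraph.adj? (A p q) w
  adjacent = filter adj? (words p q)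

  to : ∀ {v} → v ∈ map letters adjacent → v ∈ neighbours (letters w)
  to i with ∈-map⁻ letters i
  ... | u , j , refl = ~⇒∈-neighbours (proj₂ (∈-filter⁻ adj? {xs = words p q} j))

  from : ∀ {v} → v ∈ neighbours (letters w) → v ∈ map letters adjacent
  from i = ∈-map⁺ letters (∈-filter⁺ adj? (words-complete (reorder w (~⇒↭ w~v))) w~v)
    where w~v = ∈-neighbours⇒~ (letters w) i

-- Counting words by their number of turns.

#words : ∀ {ℓ} {P : Pred (List Letter) ℓ} → Decidable P → ℕ → ℕ → ℕ
#words P? p q = length (filter (P? ∘ letters) (words p q))

length-filter-map : ∀ {ℓ} {X Y : Set} {P : Pred Y ℓ} (P? : Decidable P) (f : X → Y) xs →
                    length (filter P? (map f xs)) ≡ length (filter (P? ∘ f) xs)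
length-filter-map P? f []       = refl
length-filter-map P? f (x ∷ xs) with P? (f x)
... | yes _ = cong suc (length-filter-map P? f xs)
... | no  _ = length-filter-map P? f xs

module _ {ℓ} {P : Pred (List Letter) ℓ} (P? : Decidable P) where

  -- These recursions strip the first letter. As `P?` speaks of bare letter lists, it survives the
  -- change of indices of `Word` and simply absorbs that letter.
  #words-suc-zero : ∀ p → #words P? (suc p) 0 ≡ #words (P? ∘ (a ∷_)) p 0
  #words-suc-zero p = length-filter-map (P? ∘ letters) consA (words p 0)

  #words-zero-suc : ∀ q → #words P? 0 (suc q) ≡ #words (P? ∘ (b ∷_)) 0 q
  #words-zero-suc q = length-filter-map (P? ∘ letters) consB (words 0 q)

  #words-suc-suc : ∀ p q → #words P? (suc p) (suc q) ≡
                           #words (P? ∘ (a ∷_)) p (suc q) + #words (P? ∘ (b ∷_)) (suc p) q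
  #words-suc-suc p q = begin
    length (filter P?′ (us ++ vs))                   ≡⟨ cong length (filter-++ P?′ us vs) ⟩
    length (filter P?′ us ++ filter P?′ vs)          ≡⟨ length-++ (filter P?′ us) ⟩
    length (filter P?′ us) + length (filter P?′ vs)
      ≡⟨ cong₂ _+_ (length-filter-map P?′ consA (words p (suc q)))
                   (length-filter-map P?′ consB (words (suc p) q)) ⟩
    #words (P? ∘ (a ∷_)) p (suc q) + #words (P? ∘ (b ∷_)) (suc p) q ∎
    where
    open ≡-Reasoning
    P?′ : Decidable (P ∘ letters {suc p} {suc q})
    P?′ = P? ∘ letters
    us  = map consA (words p (suc q))
    vs  = map consB (words (suc p) q)

#words-suc≟suc : ∀ (f : List Letter → ℕ) p q d →
                 #words (λ w → suc (f w) ≟ suc d) p q ≡ #words (λ w → f w ≟ d) p q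
#words-suc≟suc f p q d = cong length (filter-≐ _ _ (suc-injective , cong suc) (words p q))

#words-suc≟zero : ∀ (f : List Letter → ℕ) p q → #words (λ w → suc (f w) ≟ 0) p q ≡ 0
#words-suc≟zero f p q = cong length (filter-none _ {words p q} (All.tabulate λ _ ()))

-- The number of compositions of n into k positive parts.
comps : ℕ → ℕ → ℕ
comps zero    zero    = 1
comps zero    (suc _) = 0
comps (suc _) zero    = 0
comps (suc n) (suc k) = n C k

comps-suc : ∀ n k → comps (suc (suc n)) (suc k) ≡ comps (suc n) (suc k) + comps (suc n) k
comps-suc n zero    = refl
comps-suc n (suc k) = trans (sym (nCk+nC[k+1]≡[n+1]C[k+1] n k)) (+-comm (n C k) (n C suc k))

comps-one-suc : ∀ k → comps 1 (suc k) ≡ comps 0 k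
comps-one-suc zero    = refl
comps-one-suc (suc _) = refl

-- The leading letter is not counted by `p`, whence `suc p`. The `d + 1` runs alternate, starting
-- with `a`. Mutual induction on the second letter: an equal letter keeps `d`, a different one uses
-- up a turn and passes to the other lemma.
#turns-from-a : ∀ p q d → #words (λ w → turns (a ∷ w) ≟ d) p q ≡
                          comps (suc p) (suc ⌊ d /2⌋) * comps q ⌈ d /2⌉
#turns-from-b : ∀ p q d → #words (λ w → turns (b ∷ w) ≟ d) p q ≡
                          comps (suc q) (suc ⌊ d /2⌋) * comps p ⌈ d /2⌉

#turns-from-a zero    zero    zero    = refl
#turns-from-a zero    zero    (suc d) = sym (*-zeroʳ (comps 1 (suc ⌊ suc d /2⌋)))
#turns-from-a (suc p) zero    zero    =
  trans (#words-suc-zero (λ w → turns (a ∷ w) ≟ 0) p) (#turns-from-a p 0 0)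
#turns-from-a (suc p) zero    (suc d) =
  trans (#words-suc-zero (λ w → turns (a ∷ w) ≟ suc d) p) (trans (#turns-from-a p 0 (suc d))
    -- Without letters `b` there is no turn: both sides have the factor `comps 0 ⌈ suc d /2⌉`, which
    -- is 0.
    (trans (*-zeroʳ (p C ⌊ suc d /2⌋)) (sym (*-zeroʳ (suc p C ⌊ suc d /2⌋)))))
#turns-from-a zero    (suc q) zero    =
  trans (#words-zero-suc (λ w → turns (a ∷ w) ≟ 0) q) (#words-suc≟zero (turns ∘ (b ∷_)) 0 q)
#turns-from-a zero    (suc q) (suc d) = begin
  #words (λ w → turns (a ∷ w) ≟ suc d) 0 (suc q)        ≡⟨ #words-zero-suc (λ w → turns (a ∷ w) ≟ suc d) q ⟩
  #words (λ w → suc (turns (b ∷ w)) ≟ suc d) 0 q        ≡⟨ #words-suc≟suc (turns ∘ (b ∷_)) 0 q d ⟩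
  #words (λ w → turns (b ∷ w) ≟ d) 0 q                  ≡⟨ #turns-from-b 0 q d ⟩
  comps (suc q) (suc ⌊ d /2⌋) * comps 0 ⌈ d /2⌉         ≡⟨ *-comm (q C ⌊ d /2⌋) _ ⟩
  comps 0 ⌈ d /2⌉ * comps (suc q) (suc ⌊ d /2⌋)         ≡⟨ cong (_* (q C ⌊ d /2⌋)) (comps-one-suc ⌈ d /2⌉) ⟨
  comps 1 (suc ⌈ d /2⌉) * comps (suc q) (suc ⌊ d /2⌋)   ∎
  where open ≡-Reasoning
#turns-from-a (suc p) (suc q) zero    =
  trans (#words-suc-suc (λ w → turns (a ∷ w) ≟ 0) p q)
        (cong₂ _+_ (#turns-from-a p (suc q) 0) (#words-suc≟zero (turns ∘ (b ∷_)) (suc p) q))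
#turns-from-a (suc p) (suc q) (suc d) = begin
  #words (λ w → turns (a ∷ w) ≟ suc d) (suc p) (suc q)
    ≡⟨ #words-suc-suc (λ w → turns (a ∷ w) ≟ suc d) p q ⟩
  #words (λ w → turns (a ∷ w) ≟ suc d) p (suc q) + #words (λ w → suc (turns (b ∷ w)) ≟ suc d) (suc p) q
    ≡⟨ cong₂ _+_ (#turns-from-a p (suc q) (suc d))
                 (trans (#words-suc≟suc (turns ∘ (b ∷_)) (suc p) q d) (#turns-from-b (suc p) q d)) ⟩
  -- By definition `⌊ suc d /2⌋` is `⌈ d /2⌉` and `⌈ suc d /2⌉` is `suc ⌊ d /2⌋`, so both summands
  -- share the factor `m` and Pascal's rule applies to the rest.
  (p C k) * m + m * comps (suc p) k
    ≡⟨ cong (λ z → (p C k) * m + z) (*-comm m _) ⟩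
  (p C k) * m + comps (suc p) k * m
    ≡⟨ *-distribʳ-+ m (p C k) _ ⟨
  (p C k + comps (suc p) k) * m
    ≡⟨ cong (_* m) (comps-suc p k) ⟨
  comps (suc (suc p)) (suc k) * m ∎
  where
  open ≡-Reasoning
  k = ⌈ d /2⌉
  m = q C ⌊ d /2⌋

#turns-from-b zero    zero    zero    = refl
#turns-from-b zero    zero    (suc d) = sym (*-zeroʳ (comps 1 (suc ⌊ suc d /2⌋)))
#turns-from-b zero    (suc q) zero    =
  trans (#words-zero-suc (λ w → turns (b ∷ w) ≟ 0) q) (#turns-from-b 0 q 0)
#turns-from-b zero    (suc q) (suc d) =
  trans (#words-zero-suc (λ w → turns (b ∷ w) ≟ suc d) q) (trans (#turns-from-b 0 q (suc d))
    (trans (*-zeroʳ (q C ⌊ suc d /2⌋)) (sym (*-zeroʳ (suc q C ⌊ suc d /2⌋)))))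
#turns-from-b (suc p) zero    zero    =
  trans (#words-suc-zero (λ w → turns (b ∷ w) ≟ 0) p) (#words-suc≟zero (turns ∘ (a ∷_)) p 0)
#turns-from-b (suc p) zero    (suc d) = begin
  #words (λ w → turns (b ∷ w) ≟ suc d) (suc p) 0        ≡⟨ #words-suc-zero (λ w → turns (b ∷ w) ≟ suc d) p ⟩
  #words (λ w → suc (turns (a ∷ w)) ≟ suc d) p 0        ≡⟨ #words-suc≟suc (turns ∘ (a ∷_)) p 0 d ⟩
  #words (λ w → turns (a ∷ w) ≟ d) p 0                  ≡⟨ #turns-from-a p 0 d ⟩
  comps (suc p) (suc ⌊ d /2⌋) * comps 0 ⌈ d /2⌉         ≡⟨ *-comm (p C ⌊ d /2⌋) _ ⟩
  comps 0 ⌈ d /2⌉ * comps (suc p) (suc ⌊ d /2⌋)         ≡⟨ cong (_* (p C ⌊ d /2⌋)) (comps-one-suc ⌈ d /2⌉) ⟨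
  comps 1 (suc ⌈ d /2⌉) * comps (suc p) (suc ⌊ d /2⌋)   ∎
  where open ≡-Reasoning
#turns-from-b (suc p) (suc q) zero    =
  trans (#words-suc-suc (λ w → turns (b ∷ w) ≟ 0) p q)
        (cong₂ _+_ (#words-suc≟zero (turns ∘ (a ∷_)) p (suc q)) (#turns-from-b (suc p) q 0))
#turns-from-b (suc p) (suc q) (suc d) = begin
  #words (λ w → turns (b ∷ w) ≟ suc d) (suc p) (suc q)
    ≡⟨ #words-suc-suc (λ w → turns (b ∷ w) ≟ suc d) p q ⟩
  #words (λ w → suc (turns (a ∷ w)) ≟ suc d) p (suc q) + #words (λ w → turns (b ∷ w) ≟ suc d) (suc p) q
    ≡⟨ cong₂ _+_ (trans (#words-suc≟suc (turns ∘ (a ∷_)) p (suc q) d) (#turns-from-a p (suc q) d))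
                 (#turns-from-b (suc p) q (suc d)) ⟩
  m * comps (suc q) k + (q C k) * m
    ≡⟨ cong (_+ ((q C k) * m)) (*-comm m _) ⟩
  comps (suc q) k * m + (q C k) * m
    ≡⟨ +-comm (comps (suc q) k * m) _ ⟩
  (q C k) * m + comps (suc q) k * m
    ≡⟨ *-distribʳ-+ m (q C k) _ ⟨
  (q C k + comps (suc q) k) * m
    ≡⟨ cong (_* m) (comps-suc q k) ⟨
  comps (suc (suc q)) (suc k) * m ∎
  where
  open ≡-Reasoning
  k = ⌈ d /2⌉
  m = p C ⌊ d /2⌋

-- The summands count the words beginning with `a` and with `b`. The empty word begins with neither;
-- for `p = q = d = 0` the right side would be 0 instead of 1.
#turns : ∀ p q d → 1 ≤ p + q → #words (λ w → turns w ≟ d) p q ≡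
         comps p (suc ⌊ d /2⌋) * comps q ⌈ d /2⌉ + comps q (suc ⌊ d /2⌋) * comps p ⌈ d /2⌉
#turns (suc p) zero    d _ =
  trans (#words-suc-zero (λ w → turns w ≟ d) p) (trans (#turns-from-a p 0 d) (sym (+-identityʳ _)))
#turns zero    (suc q) d _ =
  trans (#words-zero-suc (λ w → turns w ≟ d) q) (#turns-from-b 0 q d)
#turns (suc p) (suc q) d _ =
  trans (#words-suc-suc (λ w → turns w ≟ d) p q)
        (cong₂ _+_ (#turns-from-a p (suc q) d) (#turns-from-b (suc p) q d))

#verticesOfDegree≡comps : ∀ p q d → 1 ≤ p + q → #verticesOfDegree (A p q) d ≡
  comps p (suc ⌊ d /2⌋) * comps q ⌈ d /2⌉ + comps q (suc ⌊ d /2⌋) * comps p ⌈ d /2⌉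
#verticesOfDegree≡comps p q d p+q≥1 = trans
  (cong length (filter-≐ _ _
    ((λ {v} → trans (sym (degree≡turns v))) , (λ {v} → trans (degree≡turns v))) (words p q)))
  (#turns p q d p+q≥1)

-- Positive counts and attained degrees.

module _ (G : FiniteSimpleGraph) where
  open FiniteSimpleGraph G

  -- This direction supplies vertices attaining the extremal degrees; the converse below yields the
  -- bounds on all degrees.
  #verticesOfDegree>0⇒∃ : ∀ d → 0 < #verticesOfDegree G d → ∃ λ v → degree G v ≡ d
  #verticesOfDegree>0⇒∃ d pos with filter (λ v → degree G v ≟ d) vertices in eq
  ... | v ∷ _ = v , proj₂ (∈-filter⁻ (λ u → degree G u ≟ d) {xs = vertices} (subst (v ∈_) (sym eq) (here refl)))

  #verticesOfDegree-degree>0 : ∀ v → 0 < #verticesOfDegree G (degree G v)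
  #verticesOfDegree-degree>0 v = filter-some _ (lose (complete v) refl)

comps-pos : ∀ {n k} → k < n → 0 < comps n (suc k)
comps-pos {suc n}       {zero}  _         = z<s
comps-pos {suc (suc n)} {suc k} (s≤s k<n) =
  subst (0 <_) (sym (comps-suc n (suc k))) (≤-trans (comps-pos k<n) (m≤n+m (n C k) (n C suc k)))

comps-diag-pos : ∀ n → 0 < comps n n
comps-diag-pos zero    = z<s
comps-diag-pos (suc n) = comps-pos (n<1+n n)

comps-pos⇒≤ : ∀ n k → 0 < comps n k → k ≤ n
comps-pos⇒≤ zero    zero    _   = z≤n
comps-pos⇒≤ (suc n) (suc k) pos = s≤s (≮⇒≥ λ n<k → <-irrefl (sym (k>n⇒nCk≡0 n<k)) pos)

*-pos : ∀ {m n} → 0 < m → 0 < n → 0 < m * n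
*-pos = *-mono-≤

*-pos⁻¹ : ∀ m {n} → 0 < m * n → 0 < m × 0 < n
*-pos⁻¹ (suc m) {zero}  pos = contradiction (subst (0 <_) (*-zeroʳ m) pos) λ ()
*-pos⁻¹ (suc m) {suc n} _   = z<s , z<s

+-pos⁻¹ : ∀ m {n} → 0 < m + n → 0 < m ⊎ 0 < n
+-pos⁻¹ zero    pos = inj₂ pos
+-pos⁻¹ (suc m) _   = inj₁ z<s

-- Parity, and passage from compositions to binomial coefficients.

⌊n*2/2⌋≡n : ∀ n → ⌊ n * 2 /2⌋ ≡ n
⌊n*2/2⌋≡n zero    = refl
⌊n*2/2⌋≡n (suc n) = cong suc (⌊n*2/2⌋≡n n)

⌈n*2/2⌉≡n : ∀ n → ⌈ n * 2 /2⌉ ≡ n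
⌈n*2/2⌉≡n zero    = refl
⌈n*2/2⌉≡n (suc n) = cong suc (⌈n*2/2⌉≡n n)

n*2/2≡n : ∀ n → n * 2 / 2 ≡ n
n*2/2≡n n = m*n/n≡m n 2

odd⇒≡1+k*2 : ∀ d → ¬ (2 ∣ d) → ∃ λ k → d ≡ suc (k * 2)
odd⇒≡1+k*2 zero          odd = contradiction (divides 0 refl) odd
odd⇒≡1+k*2 (suc zero)    odd = 0 , refl
odd⇒≡1+k*2 (suc (suc d)) odd with odd⇒≡1+k*2 d (λ { (divides k refl) → odd (divides (suc k) refl) })
... | k , refl = suc k , refl

binom-⊖1-+ : ∀ n k → binom (n ⊖ 1) (+ k) ≡ comps n (suc k)
binom-⊖1-+ zero    k = refl
binom-⊖1-+ (suc n) k = refl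

-- The excluded case is the junk value binom -1 -1 = 0, whereas comps 0 0 = 1.
binom-⊖1-⊖1 : ∀ n k → ¬ (n ≡ 0 × k ≡ 0) → binom (n ⊖ 1) (k ⊖ 1) ≡ comps n k
binom-⊖1-⊖1 zero    zero    ¬0 = contradiction (refl , refl) ¬0
binom-⊖1-⊖1 zero    (suc k) _  = refl
binom-⊖1-⊖1 (suc n) zero    _  = refl
binom-⊖1-⊖1 (suc n) (suc k) _  = refl

-- Vertex counts by parity and the extremal degrees.

module _ (p q : ℕ) (p+q≥1 : 1 ≤ p + q) where

  -- With evenly many turns the word begins and ends with the same letter, which has one run more
  -- than the other.
  #even : ∀ k → #verticesOfDegree (A p q) (k * 2) ≡ comps p (suc k) * comps q k + comps q (suc k) * comps p k
  #even k with eq ← #verticesOfDegree≡comps p q (k * 2) p+q≥1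
          rewrite ⌊n*2/2⌋≡n k | ⌈n*2/2⌉≡n k = eq

  -- With an odd number of turns both letters have `suc k` runs, so either choice of first letter
  -- gives the same count.
  #odd : ∀ k → #verticesOfDegree (A p q) (suc (k * 2)) ≡ 2 * comps p (suc k) * comps q (suc k)
  #odd k = begin
    #verticesOfDegree (A p q) (suc (k * 2))                ≡⟨ #verticesOfDegree≡comps p q (suc (k * 2)) p+q≥1 ⟩
    comps p (suc f) * comps q (suc g) + comps q (suc f) * comps p (suc g)
      ≡⟨ cong₂ (λ i j → comps p (suc i) * comps q (suc j) + comps q (suc i) * comps p (suc j))
               (⌈n*2/2⌉≡n k) (⌊n*2/2⌋≡n k) ⟩
    comps p (suc k) * comps q (suc k) + comps q (suc k) * comps p (suc k)
      ≡⟨ cong (λ z → comps p (suc k) * comps q (suc k) + z) (trans (*-comm (comps q (suc k)) _) (sym (+-identityʳ _))) ⟩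
    2 * (comps p (suc k) * comps q (suc k))                ≡⟨ *-assoc 2 (comps p (suc k)) _ ⟨
    2 * comps p (suc k) * comps q (suc k)                  ∎
    where
    open ≡-Reasoning
    f = ⌈ k * 2 /2⌉
    g = ⌊ k * 2 /2⌋

  -- Since `v` itself is counted, one of the two summands is positive, and `n` has a composition
  -- into `k` parts only if `k ≤ n`.
  degree-bounds : ∀ v → let d = degree (A p q) v in
                  (⌊ d /2⌋ < p × ⌈ d /2⌉ ≤ q) ⊎ (⌊ d /2⌋ < q × ⌈ d /2⌉ ≤ p)
  degree-bounds v =
    Sum.map (parts p q) (parts q p)
      (+-pos⁻¹ (comps p (suc ⌊ d /2⌋) * comps q ⌈ d /2⌉)
        (subst (0 <_) (#verticesOfDegree≡comps p q d p+q≥1) (#verticesOfDegree-degree>0 (A p q) v)))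
    where
    d = degree (A p q) v
    parts : ∀ m n → 0 < comps m (suc ⌊ d /2⌋) * comps n ⌈ d /2⌉ → ⌊ d /2⌋ < m × ⌈ d /2⌉ ≤ n
    parts m n pos with i , j ← *-pos⁻¹ (comps m (suc ⌊ d /2⌋)) pos =
      comps-pos⇒≤ m _ i , comps-pos⇒≤ n _ j

  degree≤2*[p⊓q] : ∀ v → degree (A p q) v ≤ 2 * (p ⊓ q)
  degree≤2*[p⊓q] v = begin
    d                          ≡⟨ ⌊n/2⌋+⌈n/2⌉≡n d ⟨
    ⌊ d /2⌋ + ⌈ d /2⌉          ≤⟨ +-mono-≤ (⌊n/2⌋≤⌈n/2⌉ d) (m≤m+n ⌈ d /2⌉ 0) ⟩
    2 * ⌈ d /2⌉                ≤⟨ *-monoʳ-≤ 2 (⌈d/2⌉≤p⊓q (degree-bounds v)) ⟩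
    2 * (p ⊓ q)                ∎
    where
    open ≤-Reasoning
    d = degree (A p q) v
    ⌈d/2⌉≤p⊓q : (⌊ d /2⌋ < p × ⌈ d /2⌉ ≤ q) ⊎ (⌊ d /2⌋ < q × ⌈ d /2⌉ ≤ p) → ⌈ d /2⌉ ≤ p ⊓ q
    -- At `suc d` the library inequality reads `⌈ d /2⌉ ≤ suc ⌊ d /2⌋`.
    ⌈d/2⌉≤p⊓q (inj₁ (f<p , c≤q)) = ⊓-glb (≤-trans (⌊n/2⌋≤⌈n/2⌉ (suc d)) f<p) c≤q
    ⌈d/2⌉≤p⊓q (inj₂ (f<q , c≤p)) = ⊓-glb c≤p (≤-trans (⌊n/2⌋≤⌈n/2⌉ (suc d)) f<q)

  -- Let every run of the rarer letter have length 1; the more frequent letter is numerous enough to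
  -- form one run more.
  degree-2*[p⊓q] : p ≢ q → ∃ λ v → degree (A p q) v ≡ 2 * (p ⊓ q)
  degree-2*[p⊓q] p≢q = #verticesOfDegree>0⇒∃ (A p q) (2 * (p ⊓ q))
    (subst (λ d → 0 < #verticesOfDegree (A p q) d) (*-comm (p ⊓ q) 2)
      (subst (0 <_) (sym (#even (p ⊓ q))) pos))
    where
    pos : 0 < comps p (suc (p ⊓ q)) * comps q (p ⊓ q) + comps q (suc (p ⊓ q)) * comps p (p ⊓ q)
    pos with <-cmp p q
    ... | tri< p<q _ _ rewrite m≤n⇒m⊓n≡m (<⇒≤ p<q) =
          ≤-trans (*-pos (comps-pos p<q) (comps-diag-pos p)) (m≤n+m _ (comps p (suc p) * comps q p))
    ... | tri≈ _ p≡q _ = contradiction p≡q p≢q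
    ... | tri> _ _ q<p rewrite m≥n⇒m⊓n≡n (<⇒≤ q<p) =
          ≤-trans (*-pos (comps-pos q<p) (comps-diag-pos q)) (m≤m+n _ _)

  maxDegree-≢ : p ≢ q → IsMaxDegree (A p q) (2 * (p ⊓ q))
  maxDegree-≢ p≢q = degree-2*[p⊓q] p≢q , degree≤2*[p⊓q]

  minDegree : IsMinDegree (A p q) (1 ⊓ (p * q))
  minDegree with p * q in pq
  ... | zero  = #verticesOfDegree>0⇒∃ (A p q) 0 (subst (0 <_) (sym (#even 0)) (pos p q pq p+q≥1)) , λ _ → z≤n
    where
    pos : ∀ m n → m * n ≡ 0 → 1 ≤ m + n → 0 < comps m 1 * comps n 0 + comps n 1 * comps m 0
    pos zero    (suc n) _   _ = z<s
    pos (suc m) zero    _   _ = z<s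
  ... | suc _ with 0<p , 0<q ← *-pos⁻¹ p (subst (0 <_) (sym pq) z<s) =
        #verticesOfDegree>0⇒∃ (A p q) 1
          (subst (0 <_) (sym (#odd 0)) (*-pos (*-pos {2} z<s (comps-pos 0<p)) (comps-pos 0<q)))
      -- A vertex of degree 0 would make the count for 0 positive, but each summand there asks for a
      -- positive number of letters in no runs.
      , λ v → n≢0⇒n>0 λ deg≡0 → <-irrefl (sym (trans (#even 0) (none p q 0<p 0<q)))
                (subst (λ d → 0 < #verticesOfDegree (A p q) d) deg≡0 (#verticesOfDegree-degree>0 (A p q) v))
    where
    none : ∀ m n → 0 < m → 0 < n → comps m 1 * comps n 0 + comps n 1 * comps m 0 ≡ 0
    none (suc m) (suc n) _ _ = refl

  #verticesOfOddDegree : ∀ d → ¬ (2 ∣ d) → #verticesOfDegree (A p q) d ≡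
    2 * binom (p ⊖ 1) ((d ⊖ 1) /ℕ 2) * binom (q ⊖ 1) ((d ⊖ 1) /ℕ 2)
  #verticesOfOddDegree d odd with odd⇒≡1+k*2 d odd
  ... | k , refl rewrite n*2/2≡n k | binom-⊖1-+ p k | binom-⊖1-+ q k = #odd k

  -- For `d = 0` and `p * q = 0` the binomial expression is 0, as a top entry is -1 in both
  -- products, whereas the only word has degree 0; `#verticesOfDegree-0` covers that case.
  #verticesOfEvenDegree : ∀ d → 2 ∣ d → ¬ (d ≡ 0 × p * q ≡ 0) → #verticesOfDegree (A p q) d ≡
    binom (p ⊖ 1) ((d / 2) ⊖ 1) * binom (q ⊖ 1) (+ (d / 2))
    + binom (p ⊖ 1) (+ (d / 2)) * binom (q ⊖ 1) ((d / 2) ⊖ 1)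
  #verticesOfEvenDegree _ (divides k refl) ¬0
    rewrite n*2/2≡n k | binom-⊖1-+ p k | binom-⊖1-+ q k
          | binom-⊖1-⊖1 p k (λ { (refl , refl) → ¬0 (refl , refl) })
          | binom-⊖1-⊖1 q k (λ { (refl , refl) → ¬0 (refl , *-zeroʳ p) }) =
    trans (#even k) (trans (+-comm (comps p (suc k) * comps q k) _)
      (cong (_+ (comps p (suc k) * comps q k)) (*-comm (comps q (suc k)) (comps p k))))

  #verticesOfDegree-0 : p * q ≡ 0 → #verticesOfDegree (A p q) 0 ≡ 1
  #verticesOfDegree-0 pq≡0 = trans (#even 0) (one p q pq≡0 p+q≥1)
    where
    one : ∀ m n → m * n ≡ 0 → 1 ≤ m + n → comps m 1 * comps n 0 + comps n 1 * comps m 0 ≡ 1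
    one zero    (suc n) _ _ = refl
    one (suc m) zero    _ _ = refl

-- The alternating words, with `p` runs of length 1 for each letter, attain the value. Either case
-- of `degree-bounds` gives `⌊ d /2⌋ < p` and `⌈ d /2⌉ ≤ p`, so `d < 2 * p`.
maxDegree-diag : ∀ p → 1 ≤ p + p → IsMaxDegree (A p p) (2 * p ∸ 1)
maxDegree-diag (suc n) 1≤p+p =
    #verticesOfDegree>0⇒∃ (A p p) (2 * p ∸ 1)
      -- The degree `suc (n * 2)` handled by `#odd` is `pred (p * 2)` by computation.
      (subst (λ d → 0 < #verticesOfDegree (A p p) d) (cong pred (*-comm p 2))
        (subst (0 <_) (sym (#odd p p 1≤p+p n)) (*-pos (*-pos {2} z<s (comps-diag-pos p)) (comps-diag-pos p))))
  , λ v → <⇒≤pred (begin-strict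
      degree (A p p) v                                    ≡⟨ ⌊n/2⌋+⌈n/2⌉≡n (degree (A p p) v) ⟨
      ⌊ degree (A p p) v /2⌋ + ⌈ degree (A p p) v /2⌉     <⟨ [ sum<2p , sum<2p ]′ (degree-bounds p p 1≤p+p v) ⟩
      2 * p                                               ∎)
  where
  open ≤-Reasoning
  p = suc n
  sum<2p : ∀ {f c} → f < p × c ≤ p → f + c < 2 * p
  sum<2p (f<p , c≤p) = +-mono-≤ f<p (≤-trans c≤p (m≤m+n p 0))

proposition3p5 : (p q : ℕ) → 1 ≤ p + q →
    IsMinDegree (A p q) (1 ⊓ (p * q))
    × (p ≢ q → IsMaxDegree (A p q) (2 * (p ⊓ q)))
    × (p ≡ q → IsMaxDegree (A p q) (2 * p ∸ 1))
    × ((d : ℕ) → ¬ (2 ∣ d) →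
    #verticesOfDegree (A p q) d
    ≡ 2 * binom (p ⊖ 1) ((d ⊖ 1) /ℕ 2) * binom (q ⊖ 1) ((d ⊖ 1) /ℕ 2))
    × ((d : ℕ) → 2 ∣ d → ¬ (d ≡ 0 × p * q ≡ 0) →
    #verticesOfDegree (A p q) d
    ≡ binom (p ⊖ 1) ((d / 2) ⊖ 1) * binom (q ⊖ 1) (+ (d / 2))
    + binom (p ⊖ 1) (+ (d / 2)) * binom (q ⊖ 1) ((d / 2) ⊖ 1))
    × (p * q ≡ 0 → #verticesOfDegree (A p q) 0 ≡ 1)
proposition3p5 p q p+q≥1 =
    minDegree p q p+q≥1
  , maxDegree-≢ p q p+q≥1
  , (λ { refl → maxDegree-diag p p+q≥1 })
  , #verticesOfOddDegree p q p+q≥1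
  , #verticesOfEvenDegree p q p+q≥1
  , #verticesOfDegree-0 p q p+q≥1
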